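{- Let $\mathcal{C}$ be a category with families equipped with extensional identity types $\mathsf{Id}$ and (weak) constant families $\mathsf{K}$. An object $\Gamma\in\mathsf{Con}$ of $\mathcal{C}$ supports induction, i.e. there is an element of $$\mathsf{Inductive}\,\Gamma :\equiv \big((A : \mathsf{Ty}\,\Gamma)\to \mathsf{Tm}\,\Gamma\,A\big),$$ if and only if $\Gamma$ is an initial object of the underlying category of $\mathcal{C}$. Moreover, both "$\Gamma$ supports induction" and "$\Gamma$ is initial" are mere properties (i.e. the type $\mathsf{Inductive}\,\Gamma$, and the type of witnesses that $\Gamma$ is initial, each have at most one element up to equality).
   Context: The metatheory is an extensional type theory (equality $\equiv$ satisfies uniqueness of identity proofs and function extensionality). A category with families (cwf) consists of: a category whose objects form $\mathsf{Con}$ and whose morphisms from $\Gamma$ to $\Delta$ form $\mathsf{Sub}\,\Gamma\,\Delta$, with identity $\mathsf{id}$, composition $\circ$, and a terminal object $\bullet$ with unique maps $\epsilon:\mathsf{Sub}\,\Gamma\,\bullet$; for each $\Gamma$ a set $\mathsf{Ty}\,\Gamma$ and for each $A:\mathsf{Ty}\,\Gamma$ a set $\mathsf{Tm}\,\Gamma\,A$; substitution operations sending $A:\mathsf{Ty}\,\Delta$, $t:\mathsf{Tm}\,\Delta\,A$ and $\sigma:\mathsf{Sub}\,\Gamma\,\Delta$ to $A[\sigma]:\mathsf{Ty}\,\Gamma$ and $t[\sigma]:\mathsf{Tm}\,\Gamma\,(A[\sigma])$, strictly functorial in $\sigma$; and for each $A:\mathsf{Ty}\,\Delta$ an extended context $\Delta\triangleright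 A$ with a natural bijection $\mathsf{Sub}\,\Gamma\,(\Delta\triangleright A)\simeq\big((\sigma:\mathsf{Sub}\,\Gamma\,\Delta)\times\mathsf{Tm}\,\Gamma\,(A[\sigma])\big)$; the right-to-left map is written $(\sigma,t)$, and $\mathsf{p}:\mathsf{Sub}\,(\Gamma\triangleright A)\,\Gamma$, $\mathsf{q}:\mathsf{Tm}\,(\Gamma\triangleright A)\,(A[\mathsf{p}])$ are the components of the identity. Extensional identity types: for $t,u:\mathsf{Tm}\,\Gamma\,A$ a type $\mathsf{Id}\,t\,u:\mathsf{Ty}\,\Gamma$ with a bijection $(\mathsf{reflect},\mathsf{refl}):\mathsf{Tm}\,\Gamma\,(\mathsf{Id}\,t\,u)\simeq(t\equiv u)$, everything natural with respect to substitution. (Weak) constant families: for all $\Delta,\Gamma:\mathsf{Con}$ a type $\mathsf{K}\,\Delta:\mathsf{Ty}\,\Gamma$ with a bijection $(\mathsf{app}_{\mathsf K},\mathsf{lam}_{\mathsf K}):\mathsf{Tm}\,\Gamma\,(\mathsf{K}\,\Delta)\simeq\mathsf{Sub}\,\Gamma\,\Delta$, everything natural with respect to substitution. -}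

{-# OPTIONS --with-K #-}

-- The ambient metatheory is extensional.  Uniqueness of identity proofs is
-- provided by axiom K, so every `Set ℓ` below is a set in the sense of homotopy
-- type theory; function extensionality is not assumed here and has to be an
-- explicit hypothesis wherever it is needed.

module Defs where

open import Level using (Level; Setω; suc; _⊔_)
open import Data.Product using (Σ; Σ-syntax; _×_; _,_; proj₁; proj₂)
open import Function.Bundles using (_↔_; Inverse)
open import Relation.Binary.PropositionalEquality using (_≡_; sym; cong; subst)
open import Axiom.Extensionality.Propositional using (Extensionality)

FunExt : Setω
FunExt = ∀ {a b} → Extensionality a b

record Category (o h : Level) : Set (suc (o ⊔ h)) where
  infixr 9 _∘_
  field
    Obj   : Set o
    Hom   : Obj → Obj → Set h
    id    : ∀ {Γ} → Hom Γ Γ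
    _∘_   : ∀ {Γ Δ Θ} → Hom Δ Θ → Hom Γ Δ → Hom Γ Θ
    idˡ   : ∀ {Γ Δ} (σ : Hom Γ Δ) → id ∘ σ ≡ σ
    idʳ   : ∀ {Γ Δ} (σ : Hom Γ Δ) → σ ∘ id ≡ σ
    assoc : ∀ {Γ Δ Θ Ξ} (σ : Hom Θ Ξ) (τ : Hom Δ Θ) (ρ : Hom Γ Δ) →
            (σ ∘ τ) ∘ ρ ≡ σ ∘ (τ ∘ ρ)

  IsInitial : Obj → Set (o ⊔ h)
  IsInitial Γ = ∀ Δ → Σ[ σ ∈ Hom Γ Δ ] (∀ τ → τ ≡ σ)

  IsTerminal : Obj → Set (o ⊔ h)
  IsTerminal Δ = ∀ Γ → Σ[ σ ∈ Hom Γ Δ ] (∀ τ → τ ≡ σ)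

record CwF (o h t m : Level) : Set (suc (o ⊔ h ⊔ t ⊔ m)) where
  field
    category : Category o h

  open Category category public renaming (Obj to Con; Hom to Sub)

  infixl 20 _[_]ᵀ _[_]ᵗ
  infixl 5 _▷_

  field
    ∙          : Con
    ∙-terminal : IsTerminal ∙

    Ty    : Con → Set t
    _[_]ᵀ : ∀ {Γ Δ} → Ty Δ → Sub Γ Δ → Ty Γ
    [id]ᵀ : ∀ {Γ} (A : Ty Γ) → A [ id ]ᵀ ≡ A
    [∘]ᵀ  : ∀ {Γ Δ Θ} (A : Ty Θ) (σ : Sub Δ Θ) (τ : Sub Γ Δ) →
            A [ σ ∘ τ ]ᵀ ≡ A [ σ ]ᵀ [ τ ]ᵀ

    Tm    : (Γ : Con) → Ty Γ → Set m
    _[_]ᵗ : ∀ {Γ Δ} {A : Ty Δ} → Tm Δ A → (σ : Sub Γ Δ) → Tm Γ (A [ σ ]ᵀ)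
    [id]ᵗ : ∀ {Γ} {A : Ty Γ} (a : Tm Γ A) →
            subst (Tm Γ) ([id]ᵀ A) (a [ id ]ᵗ) ≡ a
    [∘]ᵗ  : ∀ {Γ Δ Θ} {A : Ty Θ} (a : Tm Θ A) (σ : Sub Δ Θ) (τ : Sub Γ Δ) →
            subst (Tm Γ) ([∘]ᵀ A σ τ) (a [ σ ∘ τ ]ᵗ) ≡ a [ σ ]ᵗ [ τ ]ᵗ

    _▷_   : (Δ : Con) → Ty Δ → Con
    ▷-iso : ∀ {Γ Δ} (A : Ty Δ) →
            Sub Γ (Δ ▷ A) ↔ (Σ[ σ ∈ Sub Γ Δ ] Tm Γ (A [ σ ]ᵀ))

  unpair : ∀ {Γ Δ} {A : Ty Δ} → Sub Γ (Δ ▷ A) → Σ[ σ ∈ Sub Γ Δ ] Tm Γ (A [ σ ]ᵀ)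
  unpair {A = A} = Inverse.to (▷-iso A)

  -- Naturality of each bijection, here and below, is stated for its forward
  -- direction only; that of the inverse follows.
  field
    ▷-natural : ∀ {Γ Δ Θ} {A : Ty Θ} (τ : Sub Δ (Θ ▷ A)) (σ : Sub Γ Δ) →
                unpair (τ ∘ σ) ≡
                ( proj₁ (unpair τ) ∘ σ
                , subst (Tm Γ) (sym ([∘]ᵀ A (proj₁ (unpair τ)) σ))
                        (proj₂ (unpair τ) [ σ ]ᵗ) )

  pair : ∀ {Γ Δ} {A : Ty Δ} (σ : Sub Γ Δ) → Tm Γ (A [ σ ]ᵀ) → Sub Γ (Δ ▷ A)
  pair {A = A} σ a = Inverse.from (▷-iso A) (σ , a)

  p : ∀ {Γ} {A : Ty Γ} → Sub (Γ ▷ A) Γ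
  p = proj₁ (unpair id)

  q : ∀ {Γ} {A : Ty Γ} → Tm (Γ ▷ A) (A [ p ]ᵀ)
  q = proj₂ (unpair id)

  Inductive : Con → Set (t ⊔ m)
  Inductive Γ = (A : Ty Γ) → Tm Γ A

module _ {o h t m} (C : CwF o h t m) where
  open CwF C

  record ExtensionalIdentityTypes : Set (o ⊔ h ⊔ t ⊔ m) where
    field
      Id     : ∀ {Γ} {A : Ty Γ} → Tm Γ A → Tm Γ A → Ty Γ
      Id-iso : ∀ {Γ} {A : Ty Γ} (a b : Tm Γ A) → Tm Γ (Id a b) ↔ (a ≡ b)
      Id[]   : ∀ {Γ Δ} {A : Ty Δ} (a b : Tm Δ A) (σ : Sub Γ Δ) →
               Id a b [ σ ]ᵀ ≡ Id (a [ σ ]ᵗ) (b [ σ ]ᵗ)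

    reflect : ∀ {Γ} {A : Ty Γ} {a b : Tm Γ A} → Tm Γ (Id a b) → a ≡ b
    reflect {a = a} {b} = Inverse.to (Id-iso a b)

    Id-refl : ∀ {Γ} {A : Ty Γ} {a b : Tm Γ A} → a ≡ b → Tm Γ (Id a b)
    Id-refl {a = a} {b} = Inverse.from (Id-iso a b)

    field
      reflect-natural :
        ∀ {Γ Δ} {A : Ty Δ} {a b : Tm Δ A} (e : Tm Δ (Id a b)) (σ : Sub Γ Δ) →
        reflect (subst (Tm Γ) (Id[] a b σ) (e [ σ ]ᵗ)) ≡ cong _[ σ ]ᵗ (reflect e)

  record ConstantFamilies : Set (o ⊔ h ⊔ t ⊔ m) where
    field
      K     : ∀ {Γ} → Con → Ty Γ
      K-iso : ∀ {Γ} (Δ : Con) → Tm Γ (K Δ) ↔ Sub Γ Δ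
      K[]   : ∀ {Γ Θ} (Δ : Con) (σ : Sub Γ Θ) → K Δ [ σ ]ᵀ ≡ K Δ

    appK : ∀ {Γ Δ} → Tm Γ (K Δ) → Sub Γ Δ
    appK {Δ = Δ} = Inverse.to (K-iso Δ)

    lamK : ∀ {Γ Δ} → Sub Γ Δ → Tm Γ (K Δ)
    lamK {Δ = Δ} = Inverse.from (K-iso Δ)

    field
      appK-natural : ∀ {Γ Θ Δ} (a : Tm Θ (K Δ)) (σ : Sub Γ Θ) →
                     appK (subst (Tm Γ) (K[] Δ σ) (a [ σ ]ᵗ)) ≡ appK a ∘ σ

{-# OPTIONS --safe #-}

-- Induction into K Δ gives a morphism Γ → Δ, and induction into an identity type
-- makes any two terms over Γ equal; applied to terms of K Δ, this is uniqueness
-- of that morphism.  Conversely, a morphism Γ → Γ ▷ A consists of an endomorphism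
-- of Γ, which initiality forces to be id, and a term of A over it.

module Submission where

open import Defs
open import Axiom.UniquenessOfIdentityProofs.WithK using (uip)
open import Data.Product using (Σ; _×_; _,_; proj₁; proj₂)
open import Function.Bundles using (_⇔_; Inverse; mk⇔)
open import Relation.Binary.PropositionalEquality using (_≡_; refl; sym; trans; cong; subst)
open import Relation.Nullary using (Irrelevant)

module _ (funext : FunExt) {o h} (C : Category o h) where
  open Category C

  -- Each uniqueness proof applies to the other's morphism, so the morphisms agree; what remains is
  -- a family of equality proofs, settled by UIP.
  unique-irrelevant : ∀ {Γ Δ} → Irrelevant (Σ (Hom Γ Δ) λ σ → ∀ τ → τ ≡ σ)
  unique-irrelevant (σ , u) (σ′ , u′) with refl ← u′ σ =
    cong (σ ,_) (funext λ τ → uip (u τ) (u′ τ))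

  initial-irrelevant : ∀ {Γ} → Irrelevant (IsInitial Γ)
  initial-irrelevant i i′ = funext λ Δ → unique-irrelevant (i Δ) (i′ Δ)

module _ {o h t m} (C : CwF o h t m) where
  open CwF C

  initial⇒inductive : ∀ {Γ} → IsInitial Γ → Inductive Γ
  initial⇒inductive {Γ} initial A =
    subst (Tm Γ) (trans (cong (A [_]ᵀ) endo≡id) ([id]ᵀ A)) (proj₂ (unpair section))
    where
    section : Sub Γ (Γ ▷ A)
    section = proj₁ (initial (Γ ▷ A))

    -- Initiality compares a morphism only with the chosen one, so the two endomorphisms meet there.
    endo≡id : proj₁ (unpair section) ≡ id
    endo≡id = trans (proj₂ (initial Γ) _) (sym (proj₂ (initial Γ) id))

  module _ (I : ExtensionalIdentityTypes C) where
    open ExtensionalIdentityTypes I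

    inductive⇒Tm-irrelevant : ∀ {Γ} → Inductive Γ → (A : Ty Γ) → Irrelevant (Tm Γ A)
    inductive⇒Tm-irrelevant ind A a b = reflect (ind (Id a b))

    -- The first element already collapses every `Tm Γ A`, so the two agree at each type.
    inductive-irrelevant : FunExt → ∀ {Γ} → Irrelevant (Inductive Γ)
    inductive-irrelevant funext ind ind′ =
      funext λ A → inductive⇒Tm-irrelevant ind A (ind A) (ind′ A)

    inductive⇒initial : ConstantFamilies C → ∀ {Γ} → Inductive Γ → IsInitial Γ
    inductive⇒initial F ind Δ = appK (ind (K Δ)) , λ τ →
      -- Writing `τ` as `appK (lamK τ)` moves the comparison to terms of `K Δ`.
      trans (sym (Inverse.strictlyInverseˡ (K-iso Δ) τ))
            (cong appK (inductive⇒Tm-irrelevant ind (K Δ) (lamK τ) (ind (K Δ))))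
      where open ConstantFamilies F

theorem1 : FunExt →
    ∀ {o h t m} (C : CwF o h t m) →
    ExtensionalIdentityTypes C →
    ConstantFamilies C →
    let open CwF C in
    (Γ : Con) →
    (Inductive Γ ⇔ IsInitial Γ) × Irrelevant (Inductive Γ) × Irrelevant (IsInitial Γ)
theorem1 funext C I F Γ =
  mk⇔ (inductive⇒initial C I F) (initial⇒inductive C) ,
  inductive-irrelevant C I funext ,
  initial-irrelevant funext (CwF.category C)
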